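{- Let $m,n\ge1$ be integers. Then $|\mathrm{sPF}(K_{m+1,n})|=|\mathrm{sPF}(K_{n+1,m})|$. More generally, for all integers $a,b\ge1$, \[ |\mathrm{sPF}(K_{m+1,n}^{a,b})|=|\mathrm{sPF}(K_{n+1,m}^{a,b})|. \]
   Context: $\mathbb{N}=\{0,1,2,\dots\}$, $[N]=\{1,\dots,N\}$. $K_{m+1,n}$ is the complete bipartite graph on $\{0,1,\dots,m\}\sqcup\{m+1,\dots,m+n\}$ with root $0$ (in the part of size $m+1$). $K_{m+1,n}^{a,b}$ is the complete bipartite multigraph on the same vertex set, with root $0$, having $a$ edges between $0$ and each $j\in\{m+1,\dots,m+n\}$ and $b$ edges between each $i\in\{1,\dots,m\}$ and each $j\in\{m+1,\dots,m+n\}$ (and no other edges). $K_{n+1,m}$, $K_{n+1,m}^{a,b}$ are obtained by exchanging the roles of $m$ and $n$ (root $0$ in the part of size $n+1$). Spherical parking functions: let $G$ be an undirected loopless (multi)graph on $V=\{0,1,\dots,N\}$, $N\ge 2$, with root $0$ and $a_{ij}$ edges between $i$ and $j$ (here $N=m+n$). Let $R=\mathbb{K}[x_1,\dots,x_N]$ over a field $\mathbb{K}$. For $\emptyset\ne A\subseteq[N]$ put $d_A(i)=\sum_{j\in V\setminus A}a_{ij}$ and $m_A=\prod_{i\in A}x_i^{d_A(i)}$. Let $\mathcal{M}_G=\langle m_A:\emptyset\neq A\subseteq[N]\rangle$ and $\mathcal{M}_G^{(k)}=\langle m_A:\emptyset\ne A\subseteq[N],\ |A|\le k+1\rangle$.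 Then $\mathrm{sPF}(G)=\{\mathcal{P}\in\mathbb{N}^N:\ \mathbf{x}^{\mathcal{P}}\in\mathcal{M}_G\setminus\mathcal{M}_G^{(N-2)}\}$. -}

module Defs where

open import Algebra.Apartness.Bundles using (HeytingField)
open import Data.Bool.Base using (if_then_else_)
open import Data.Fin.Base using (Fin; zero; suc; splitAt)
open import Data.Fin.Subset using (Subset; Nonempty; ∣_∣; ∁; outside)
open import Data.List.Base as List using (List; []; _∷_; _++_; foldr; cartesianProductWith)
open import Data.Nat.Base as ℕ using (ℕ; suc; _≤_; _∸_)
open import Data.Nat.Properties using (_≟_; +-0-commutativeMonoid)
open import Data.Product.Base using (Σ; ∃; _×_; _,_; proj₁)
open import Data.Sum.Base using (_⊎_; inj₁; inj₂)
open import Data.Vec.Base as Vec using (Vec; lookup; tabulate; zipWith)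
open import Data.Vec.Properties using (≡-dec)
open import Function.Bundles using (Bijection)
open import Level using (Level; _⊔_)
open import Relation.Binary.Bundles using (Setoid)
open import Relation.Binary.PropositionalEquality using (_≡_; refl; setoid)
open import Relation.Nullary using (does)
open import Relation.Unary using (Pred; _∈_; _∉_)
import Relation.Binary.Construct.On as On

open import Algebra.Properties.CommutativeMonoid.Sum +-0-commutativeMonoid using (sum)

-- The vertex set {0,…,N} is Fin (suc N), with root zero.  Subsets of
-- [N] = {1,…,N} are of type Subset N, where i : Fin N stands for the vertex suc i.

record Multigraph (N : ℕ) : Set where
  field
    edges     : Fin (suc N) → Fin (suc N) → ℕ
    edges-sym : ∀ i j → edges i j ≡ edges j i
    loopless  : ∀ i → edges i i ≡ 0

-- The bipartite multigraph on {0,…,m} ⊔ {m+1,…,m+n} with w i j edges between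
-- the i-th vertex of the first part and the j-th vertex of the second part.

module _ (m n : ℕ) (w : Fin (suc m) → Fin n → ℕ) where

  bipartiteEdges : Fin (suc m) ⊎ Fin n → Fin (suc m) ⊎ Fin n → ℕ
  bipartiteEdges (inj₁ _) (inj₁ _) = 0
  bipartiteEdges (inj₁ i) (inj₂ j) = w i j
  bipartiteEdges (inj₂ j) (inj₁ i) = w i j
  bipartiteEdges (inj₂ _) (inj₂ _) = 0

  bipartiteEdges-sym : ∀ u v → bipartiteEdges u v ≡ bipartiteEdges v u
  bipartiteEdges-sym (inj₁ _) (inj₁ _) = refl
  bipartiteEdges-sym (inj₁ _) (inj₂ _) = refl
  bipartiteEdges-sym (inj₂ _) (inj₁ _) = refl
  bipartiteEdges-sym (inj₂ _) (inj₂ _) = refl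

  bipartiteEdges-loopless : ∀ u → bipartiteEdges u u ≡ 0
  bipartiteEdges-loopless (inj₁ _) = refl
  bipartiteEdges-loopless (inj₂ _) = refl

  bipartite : Multigraph (m ℕ.+ n)
  bipartite = record
    { edges     = λ i j → bipartiteEdges (splitAt (suc m) i) (splitAt (suc m) j)
    ; edges-sym = λ i j → bipartiteEdges-sym (splitAt (suc m) i) (splitAt (suc m) j)
    ; loopless  = λ i → bipartiteEdges-loopless (splitAt (suc m) i)
    }

-- K[ m +1, n ] is K_{m+1,n}, and K[ m +1, n ]^[ a , b ] is K_{m+1,n}^{a,b}.

K[_+1,_] : (m n : ℕ) → Multigraph (m ℕ.+ n)
K[ m +1, n ] = bipartite m n (λ _ _ → 1)

K[_+1,_]^[_,_] : (m n a b : ℕ) → Multigraph (m ℕ.+ n)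
K[ m +1, n ]^[ a , b ] = bipartite m n weight
  module K^[a,b] where
  weight : Fin (suc m) → Fin n → ℕ
  weight zero    _ = a
  weight (suc _) _ = b

module _ {N : ℕ} (G : Multigraph N) where
  open Multigraph G

  -- d_A(i) = Σ_{j ∈ V∖A} a_{ij}; the root is never in A.
  d : Subset N → Fin N → ℕ
  d A i = sum λ j → if lookup (∁ (outside Vec.∷ A)) j then edges (suc i) j else 0

  -- The exponent vector of m_A = ∏_{i ∈ A} x_i ^ d_A(i).
  exponent : Subset N → Vec ℕ N
  exponent A = tabulate λ i → if lookup A i then d A i else 0

module _ {c ℓ₁ ℓ₂ : Level} (K : HeytingField c ℓ₁ ℓ₂) where
  open HeytingField K using (Carrier; _≈_; _+_; _*_; 0#; 1#)

  -- K[x₁,…,x_N]: formal sums of terms c·x^e, in which exponents may repeat,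
  -- identified when they have the same coefficients.

  Poly : ℕ → Set c
  Poly N = List (Carrier × Vec ℕ N)

  module _ {N : ℕ} where

    coeff : Poly N → Vec ℕ N → Carrier
    coeff p e = foldr (λ (c , e′) s → (if does (≡-dec _≟_ e′ e) then c else 0#) + s) 0# p

    _≈ₚ_ : Poly N → Poly N → Set ℓ₁
    p ≈ₚ q = ∀ e → coeff p e ≈ coeff q e

    0ₚ : Poly N
    0ₚ = []

    _+ₚ_ : Poly N → Poly N → Poly N
    _+ₚ_ = _++_

    _*ₚ_ : Poly N → Poly N → Poly N
    _*ₚ_ = cartesianProductWith λ (c , e) (c′ , e′) → c * c′ , zipWith ℕ._+_ e e′

    x^_ : Vec ℕ N → Poly N
    x^ e = List.[ 1# , e ]

    -- The ideal generated by a family: all finite combinations Σ g · h i.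
    ⟨_⟩ : {I : Set} → (I → Poly N) → Pred (Poly N) (c ⊔ ℓ₁)
    ⟨_⟩ {I} h f = ∃ λ (ts : List (Poly N × I)) →
      f ≈ₚ foldr (λ (g , i) s → (g *ₚ h i) +ₚ s) 0ₚ ts

  module _ {N : ℕ} (G : Multigraph N) where

    monomial : Subset N → Poly N
    monomial A = x^ exponent G A

    𝓜 : Pred (Poly N) (c ⊔ ℓ₁)
    𝓜 = ⟨ (λ ((A , _) : Σ (Subset N) Nonempty) → monomial A) ⟩

    𝓜^⟨_⟩ : ℕ → Pred (Poly N) (c ⊔ ℓ₁)
    𝓜^⟨ k ⟩ = ⟨ (λ ((A , _) : Σ (Subset N) λ A → Nonempty A × ∣ A ∣ ≤ k ℕ.+ 1) → monomial A) ⟩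

    -- Only meaningful for N ≥ 2, where N ∸ 2 is the true difference.
    sPF : Pred (Vec ℕ N) (c ⊔ ℓ₁)
    sPF P = (x^ P) ∈ 𝓜 × (x^ P) ∉ 𝓜^⟨ N ∸ 2 ⟩

-- Elements of a subset are compared by their underlying value, ignoring the
-- membership proofs, so that HasCardinality counts each element once.

subsetSetoid : ∀ {a ℓ} {A : Set a} → Pred A ℓ → Setoid (a ⊔ ℓ) a
subsetSetoid {A = A} S = On.setoid {B = ∃ S} (setoid A) proj₁

HasCardinality : ∀ {a ℓ} {A : Set a} → Pred A ℓ → ℕ → Set (a ⊔ ℓ)
HasCardinality S k = Bijection (subsetSetoid S) (setoid (Fin k))

-- S and T are finite with ∣S∣ = ∣T∣.
SameFiniteCardinality : ∀ {a b ℓ ℓ′} {A : Set a} {B : Set b} → Pred A ℓ → Pred B ℓ′ → Set (a ⊔ b ⊔ ℓ ⊔ ℓ′)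
SameFiniteCardinality S T = ∃ λ k → HasCardinality S k × HasCardinality T k

{-# OPTIONS --safe #-}

-- Membership of a monomial in a monomial ideal is divisibility by a generator, so
-- P is a spherical parking function iff m_[N] divides x^P and no m_A with A
-- nonempty and proper does.  For K_{m+1,n}^{a,b} write P = (p , q) and A = S ⊔ T
-- along the two parts: m_A divides x^P iff p ≥ b(n − |T|) on S and
-- q ≥ a + b(m − |S|) on T, and m_[N] divides it iff q ≥ a.  After subtracting a from
-- q these conditions are symmetric in the two parts, so (p , q) ↦ (q − a , p + a)
-- is a bijection.  Finiteness comes from the singletons A = {i}.

module Submission where

open import Defs
open import Algebra.Apartness.Bundles using (HeytingField)
import Algebra.Apartness.Properties.HeytingCommutativeRing as HeytingProperties
open import Data.Bool.Base using (true; false; if_then_else_; not)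
open import Data.Fin.Base using (Fin; zero; suc; _↑ˡ_; _↑ʳ_)
open import Data.Fin.Properties using (all?; splitAt-↑ˡ; splitAt-↑ʳ)
open import Data.Fin.Subset using (Subset; Nonempty; ∣_∣; ∁; ⊤; ⁅_⁆; inside; outside)
open import Data.Fin.Subset.Properties using (anySubset?; nonempty?; ∣p∣≡n⇒p≡⊤; ∣p∣≤n; ∣⊤∣≡n; ∈⊤; x∈⁅x⁆; x∈⁅y⁆⇒x≡y; ∣⁅x⁆∣≡1)
open import Data.List.Base as List using (List; []; _∷_; cartesianProductWith; filter; length; upTo)
open import Data.List.Membership.Propositional using () renaming (_∈_ to _∈ˡ_)
open import Data.List.Membership.Propositional.Properties using (∈-cartesianProductWith⁺; ∈-upTo⁺; ∈-filter⁺; ∈-filter⁻; ∈-lookup)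
import Data.List.Membership.Setoid.Properties as Membership
open import Data.List.Relation.Unary.All as All using (All; []; _∷_)
open import Data.List.Relation.Unary.All.Properties using (++⁺)
open import Data.List.Relation.Unary.AllPairs using ([]; _∷_)
open import Data.List.Relation.Unary.Any using (here; index)
open import Data.List.Relation.Unary.Any.Properties using (lookup-index)
open import Data.List.Relation.Unary.Unique.Propositional using (Unique)
import Data.List.Relation.Unary.Unique.Propositional.Properties as Unique
open import Data.Nat.Base using (ℕ; zero; suc; _+_; _∸_; _≤_; _<_; _≥_; z≤n; s≤s)
open import Data.Nat.Properties
open import Data.Product.Base using (Σ; ∃; _×_; _,_; proj₁; proj₂)
open import Data.Vec.Base as Vec using (Vec; []; _∷_; _++_; lookup; tabulate; zipWith; map; take; drop)
open import Data.Vec.Properties using (≡-dec; lookup∘tabulate; lookup-++ˡ; lookup-++ʳ; lookup-map; lookup-zipWith; map-++; take++drop≡id; ∷-injective; []=⇒lookup; lookup⇒[]=)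
open import Data.Vec.Relation.Binary.Pointwise.Extensional using (ext; Pointwise-≡⇒≡)
open import Function.Base using (_∘_)
open import Function.Bundles using (Bijection)
import Function.Construct.Composition as Compose
open import Relation.Binary.PropositionalEquality using (_≡_; _≢_; refl; sym; trans; cong; cong₂; subst; subst₂; setoid)
open import Relation.Nullary using (¬_; Dec; does; contradiction; ¬?; _×-dec_)
open import Relation.Nullary.Decidable using (map′; dec-true; dec-false; decidable-stable)
open import Relation.Unary using (Pred; Decidable; _∈_)
open import Algebra.Properties.CommutativeMonoid.Sum +-0-commutativeMonoid using (sum; sum-cong-≗; sum-replicate-zero)

_≤ᵥ_ : ∀ {N} → Vec ℕ N → Vec ℕ N → Set
e ≤ᵥ f = ∀ i → lookup e i ≤ lookup f i

_≤ᵥ?_ : ∀ {N} (e f : Vec ℕ N) → Dec (e ≤ᵥ f)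
e ≤ᵥ? f = all? λ i → lookup e i ≤? lookup f i

lookup-extensional : ∀ {N} {e f : Vec ℕ N} → (∀ i → lookup e i ≡ lookup f i) → e ≡ f
lookup-extensional eq = Pointwise-≡⇒≡ (ext eq)

-- Cardinalities

unique⇒lookup-injective : ∀ {a} {A : Set a} {xs : List A} → Unique xs →
  ∀ i j → List.lookup xs i ≡ List.lookup xs j → i ≡ j
unique⇒lookup-injective (_   ∷ _)  zero    zero    _  = refl
unique⇒lookup-injective (x∉ ∷ _)  zero    (suc j) eq = contradiction eq (All.lookup x∉ (∈-lookup j))
unique⇒lookup-injective (x∉ ∷ _)  (suc i) zero    eq = contradiction (sym eq) (All.lookup x∉ (∈-lookup i))
unique⇒lookup-injective (_   ∷ xs) (suc i) (suc j) eq = cong suc (unique⇒lookup-injective xs i j eq)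

-- An element is sent to its position in `xs`. Positions are read off membership proofs, which may
-- differ for equal values; `Unique` makes the map respect the equality of `subsetSetoid`.
enumeration⇒HasCardinality : ∀ {a ℓ} {A : Set a} {S : Pred A ℓ} (xs : List A) → Unique xs →
  (∀ {x} → x ∈ S → x ∈ˡ xs) → (∀ {x} → x ∈ˡ xs → x ∈ S) → HasCardinality S (length xs)
enumeration⇒HasCardinality {A = A} {S} xs unique to from = record
  { to        = position
  ; cong      = λ {x} {y} eq → unique⇒lookup-injective unique _ _
                  (trans (lookup-position x) (trans eq (sym (lookup-position y))))
  ; bijective = (λ {x} {y} → Membership.index-injective (setoid A) (to (proj₂ x)) (to (proj₂ y)))
              , λ i → (List.lookup xs i , from (∈-lookup i))
                    , λ {x} eq → unique⇒lookup-injective unique _ _ (trans (lookup-position x) eq)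
  }
  where
  position : ∃ S → Fin (length xs)
  position (_ , x∈S) = index (to x∈S)

  lookup-position : ∀ x → List.lookup xs (position x) ≡ proj₁ x
  lookup-position (_ , x∈S) = sym (lookup-index (to x∈S))

-- The inverse laws are asked for only on `S` and `T`, because the truncated subtraction in
-- `exchange` can be undone only on vectors with large enough entries.
inverse⇒Bijection : ∀ {a b ℓ ℓ′} {A : Set a} {B : Set b} {S : Pred A ℓ} {T : Pred B ℓ′}
  (f : A → B) (g : B → A) →
  (∀ {x} → x ∈ S → f x ∈ T) → (∀ {y} → y ∈ T → g y ∈ S) →
  (∀ {x} → x ∈ S → g (f x) ≡ x) → (∀ {y} → y ∈ T → f (g y) ≡ y) →
  Bijection (subsetSetoid S) (subsetSetoid T)
inverse⇒Bijection f g f-∈ g-∈ gf fg = record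
  { to        = λ (x , x∈S) → f x , f-∈ x∈S
  ; cong      = cong f
  ; bijective = (λ {(_ , x∈S)} {(_ , y∈S)} eq → trans (sym (gf x∈S)) (trans (cong g eq) (gf y∈S)))
              , λ (y , y∈T) → (g y , g-∈ y∈T) , λ eq → trans (cong f eq) (fg y∈T)
  }

vectorsBelow : ∀ {N} → Vec ℕ N → List (Vec ℕ N)
vectorsBelow []       = [] ∷ []
vectorsBelow (b ∷ bs) = cartesianProductWith _∷_ (upTo b) (vectorsBelow bs)

vectorsBelow-unique : ∀ {N} (bs : Vec ℕ N) → Unique (vectorsBelow bs)
vectorsBelow-unique []       = [] ∷ []
vectorsBelow-unique (b ∷ bs) =
  Unique.cartesianProductWith⁺ _∷_ ∷-injective (Unique.upTo⁺ b) (vectorsBelow-unique bs)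

∈-vectorsBelow : ∀ {N} (bs : Vec ℕ N) {v} → (∀ i → lookup v i < lookup bs i) → v ∈ˡ vectorsBelow bs
∈-vectorsBelow []       {[]}    _  = here refl
∈-vectorsBelow (b ∷ bs) {_ ∷ _} v< =
  ∈-cartesianProductWith⁺ _∷_ (∈-upTo⁺ (v< zero)) (∈-vectorsBelow bs (v< ∘ suc))

-- Monomial ideals

module _ {c ℓ₁ ℓ₂} (K : HeytingField c ℓ₁ ℓ₂) where
  private
    module K = HeytingField K
    open HeytingProperties K.heytingCommutativeRing using (1#0)

  module _ {N : ℕ} where

    coeff-absent : ∀ {P : Vec ℕ N} {f : Poly K N} → All (λ (_ , e) → e ≢ P) f → coeff K f P K.≈ K.0#
    coeff-absent [] = K.refl
    coeff-absent {P} {(_ , e) ∷ _} (e≢P ∷ rest)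
      rewrite dec-false (≡-dec _≟_ e P) e≢P =
      K.trans (K.+-identityˡ _) (coeff-absent rest)

    -- Each term of the product has exponent `e′ + e`, which dominates `e`.
    multiple-absent : ∀ {e P : Vec ℕ N} → ¬ e ≤ᵥ P → (g : Poly K N) →
      All (λ (_ , e′) → e′ ≢ P) (_*ₚ_ K g (x^_ K e))
    multiple-absent e≰P []            = []
    multiple-absent {e} e≰P ((_ , e′) ∷ g) =
      (λ { refl → e≰P λ i → ≤-trans (m≤n+m _ _) (≤-reflexive (sym (lookup-zipWith _+_ i e′ e))) })
      ∷ multiple-absent e≰P g

    module _ {I : Set} (e : I → Vec ℕ N) (P : Vec ℕ N) where

      -- If no generator divides, no term of the combination has exponent `P`. Comparing
      -- coefficients at `P` then gives `1 ≈ 0`, against `1#0`.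
      x^∈⟨⟩⇒¬¬divisible : (x^_ K P) ∈ ⟨_⟩ K (λ i → x^_ K (e i)) → ¬ ¬ (∃ λ i → e i ≤ᵥ P)
      x^∈⟨⟩⇒¬¬divisible (ts , eq) none =
        K.#-irrefl (K.trans (K.sym coeff-x^P) (K.trans (eq P) (coeff-absent (absent ts)))) 1#0
        where
        coeff-x^P : coeff K (x^_ K P) P K.≈ K.1#
        coeff-x^P rewrite dec-true (≡-dec _≟_ P P) refl = K.+-identityʳ K.1#

        absent : ∀ ts → All (λ (_ , e′) → e′ ≢ P)
          (List.foldr (λ (g , i) s → _+ₚ_ K (_*ₚ_ K g (x^_ K (e i))) s) (0ₚ K) ts)
        absent []             = []
        absent ((g , i) ∷ ts) = ++⁺ (multiple-absent (λ ei≤P → none (i , ei≤P)) g) (absent ts)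

      divisible⇒x^∈⟨⟩ : (∃ λ i → e i ≤ᵥ P) → (x^_ K P) ∈ ⟨_⟩ K (λ i → x^_ K (e i))
      -- The single cofactor is the quotient monomial; truncated subtraction is exact because `e i`
      -- lies below `P`.
      divisible⇒x^∈⟨⟩ (i , ei≤P) = (x^_ K (zipWith _∸_ P (e i)) , i) ∷ [] , same-coeff
        where
        quotient : zipWith _+_ (zipWith _∸_ P (e i)) (e i) ≡ P
        quotient = lookup-extensional λ k →
          trans (lookup-zipWith _+_ k (zipWith _∸_ P (e i)) (e i))
            (trans (cong (_+ lookup (e i) k) (lookup-zipWith _∸_ k P (e i))) (m∸n+n≡m (ei≤P k)))

        same-coeff : ∀ f → coeff K (x^_ K P) f K.≈
          coeff K ((K.1# K.* K.1# , zipWith _+_ (zipWith _∸_ P (e i)) (e i)) ∷ []) f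
        same-coeff f rewrite quotient with does (≡-dec _≟_ P f)
        ... | true  = K.+-congʳ (K.sym (K.*-identityˡ K.1#))
        ... | false = K.refl

      x^∈⟨⟩⇒divisible : Dec (∃ λ i → e i ≤ᵥ P) →
        (x^_ K P) ∈ ⟨_⟩ K (λ i → x^_ K (e i)) → ∃ λ i → e i ≤ᵥ P
      x^∈⟨⟩⇒divisible div? P∈ = decidable-stable div? (x^∈⟨⟩⇒¬¬divisible P∈)

    -- `Q` is left open so that one search over all subsets serves both ideals, with `Nonempty` and
    -- with `Small`.
    divisible? : ∀ {Q : Subset N → Set} → Decidable Q → (e : Subset N → Vec ℕ N) → ∀ P →
      Dec (∃ λ ((A , _) : Σ (Subset N) Q) → e A ≤ᵥ P)
    divisible? Q? e P = map′ (λ (A , q , le) → (A , q) , le) (λ ((A , q) , le) → A , q , le)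
      (anySubset? λ A → Q? A ×-dec (e A ≤ᵥ? P))

  -- Spherical parking functions

  module _ {N : ℕ} (G : Multigraph N) where

    -- The index condition of `𝓜^⟨ N ∸ 2 ⟩`. For `N ≥ 2` the bound is `N - 1`, so these are the
    -- nonempty proper subsets.
    Small : Subset N → Set
    Small A = Nonempty A × ∣ A ∣ ≤ N ∸ 2 + 1

    small? : Decidable Small
    small? A = nonempty? A ×-dec (∣ A ∣ ≤? N ∸ 2 + 1)

    -- Equality in the field need not be decidable; membership in either ideal is, being
    -- divisibility by one of finitely many generators.
    sPF? : Decidable (sPF K G)
    sPF? P = member? nonempty? ×-dec ¬? (member? small?)
      where
      member? : ∀ {Q : Subset N → Set} → Decidable Q →
        Dec ((x^_ K P) ∈ ⟨_⟩ K (λ ((A , _) : Σ (Subset N) Q) → monomial K G A))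
      member? Q? = map′ (divisible⇒x^∈⟨⟩ _ P) (x^∈⟨⟩⇒divisible _ P div?) div?
        where div? = divisible? Q? (exponent G) P

    sPF⇒∤ : ∀ P {A} → P ∈ sPF K G → Small A → ¬ exponent G A ≤ᵥ P
    sPF⇒∤ P (_ , P∉) small A≤P = P∉ (divisible⇒x^∈⟨⟩ _ P ((_ , small) , A≤P))

    -- Some generator divides `x^ P`, and its subset is not `Small`, so it must have all `N`
    -- elements.
    sPF⇒⊤∣ : ∀ P → P ∈ sPF K G → exponent G ⊤ ≤ᵥ P
    sPF⇒⊤∣ P P∈@(P∈𝓜 , _)
      with (A , A≢∅) , A≤P ← x^∈⟨⟩⇒divisible _ P (divisible? nonempty? (exponent G) P) P∈𝓜
      = subst (λ A → exponent G A ≤ᵥ P) (∣p∣≡n⇒p≡⊤ {p = A} (≤-antisym (∣p∣≤n A) N≤∣A∣)) A≤P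
      where
      N≤∣A∣ : N ≤ ∣ A ∣
      -- Exceeding the bound means `2 + (N ∸ 2) ≤ ∣ A ∣`, and the left side is at least `N` even
      -- when the subtraction truncates.
      N≤∣A∣ = ≤-trans (m≤n+m∸n N 2)
        (subst (λ k → suc k ≤ ∣ A ∣) (+-comm (N ∸ 2) 1) (≰⇒> λ ∣A∣≤ → sPF⇒∤ P P∈ (A≢∅ , ∣A∣≤) A≤P))

    ⊤∣∧∤⇒sPF : ∀ P → Nonempty (⊤ {N}) → exponent G ⊤ ≤ᵥ P →
      (∀ {A} → Small A → ¬ exponent G A ≤ᵥ P) → P ∈ sPF K G
    ⊤∣∧∤⇒sPF P ⊤≢∅ ⊤≤P ∤P =
        divisible⇒x^∈⟨⟩ _ P ((_ , ⊤≢∅) , ⊤≤P)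
      , λ P∈ → let ((_ , small) , A≤P) = x^∈⟨⟩⇒divisible _ P (divisible? small? (exponent G) P) P∈
               in ∤P small A≤P

    singleton-small : ∀ i → Small ⁅ i ⁆
    singleton-small i = (i , x∈⁅x⁆ i) , ≤-trans (≤-reflexive (∣⁅x⁆∣≡1 i)) (m≤n+m 1 (N ∸ 2))

    singleton-≤ᵥ : ∀ P i → d G ⁅ i ⁆ i ≤ lookup P i → exponent G ⁅ i ⁆ ≤ᵥ P
    singleton-≤ᵥ P i le j
      rewrite lookup∘tabulate (λ k → if lookup ⁅ i ⁆ k then d G ⁅ i ⁆ k else 0) j
      with lookup ⁅ i ⁆ j in eq
    ... | false = z≤n
    ... | true  with refl ← x∈⁅y⁆⇒x≡y i (lookup⇒[]= j ⁅ i ⁆ eq) = le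

    -- The generator of `⁅ i ⁆` is a power of one variable and does not divide `x^ P`, which bounds
    -- the entry of `P` at `i`. Filtering the resulting finite box by `sPF?` enumerates the set.
    sPF-finite : ∃ (HasCardinality (sPF K G))
    sPF-finite = _ , enumeration⇒HasCardinality (filter sPF? (vectorsBelow bound))
      (Unique.filter⁺ sPF? (vectorsBelow-unique bound))
      (λ {P} P∈ → ∈-filter⁺ sPF? (∈-vectorsBelow bound (bounded P P∈)) P∈)
      (λ P∈ → proj₂ (∈-filter⁻ sPF? {xs = vectorsBelow bound} P∈))
      where
      bound : Vec ℕ N
      bound = tabulate λ i → d G ⁅ i ⁆ i

      bounded : ∀ P → P ∈ sPF K G → ∀ i → lookup P i < lookup bound i
      bounded P P∈ i rewrite lookup∘tabulate (λ i → d G ⁅ i ⁆ i) i =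
        ≰⇒> λ le → sPF⇒∤ P P∈ (singleton-small i) (singleton-≤ᵥ P i le)

-- Exchanging the two parts

sum-↑ : ∀ m {n} (f : Fin (m + n) → ℕ) → sum f ≡ sum (f ∘ (_↑ˡ n)) + sum (f ∘ (m ↑ʳ_))
sum-↑ zero    f = refl
sum-↑ (suc m) f = trans (cong (f zero +_) (sum-↑ m (f ∘ suc))) (sym (+-assoc (f zero) _ _))

sum-zero : ∀ {n} {f : Fin n → ℕ} → (∀ i → f i ≡ 0) → sum f ≡ 0
sum-zero {n} f≡0 = trans (sum-cong-≗ f≡0) (sum-replicate-zero n)

if-zero : ∀ t → (if t then 0 else 0) ≡ 0
if-zero true  = refl
if-zero false = refl

∣++∣ : ∀ {m n} (S : Subset m) (T : Subset n) → ∣ S ++ T ∣ ≡ ∣ S ∣ + ∣ T ∣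
∣++∣ []            T = refl
∣++∣ (outside ∷ S) T = ∣++∣ S T
∣++∣ (inside  ∷ S) T = cong suc (∣++∣ S T)

∣++∣-swap : ∀ {m n} (S : Subset m) (T : Subset n) → ∣ T ++ S ∣ ≡ ∣ S ++ T ∣
∣++∣-swap S T = trans (∣++∣ T S) (trans (+-comm ∣ T ∣ ∣ S ∣) (sym (∣++∣ S T)))

⊤-++ : ∀ m n → ⊤ {m + n} ≡ ⊤ {m} ++ ⊤ {n}
⊤-++ m n = sym (∣p∣≡n⇒p≡⊤ (trans (∣++∣ (⊤ {m}) (⊤ {n})) (cong₂ _+_ (∣⊤∣≡n m) (∣⊤∣≡n n))))

∣p∣>0⇒nonempty : ∀ {n} (p : Subset n) → 0 < ∣ p ∣ → Nonempty p
∣p∣>0⇒nonempty (inside  ∷ _) _  = zero , Vec.here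
∣p∣>0⇒nonempty (outside ∷ p) p> = let (x , x∈p) = ∣p∣>0⇒nonempty p p> in suc x , Vec.there x∈p

nonempty⇒∣p∣>0 : ∀ {n} (p : Subset n) → Nonempty p → 0 < ∣ p ∣
nonempty⇒∣p∣>0 (inside  ∷ _) _                     = s≤s z≤n
nonempty⇒∣p∣>0 (outside ∷ p) (suc x , Vec.there x∈p) = nonempty⇒∣p∣>0 p (x , x∈p)

lookup-∁-++ˡ : ∀ {m n} (S : Subset m) (T : Subset n) i → lookup (∁ (S ++ T)) (i ↑ˡ n) ≡ lookup (∁ S) i
lookup-∁-++ˡ S T i rewrite map-++ not S T = lookup-++ˡ (∁ S) (∁ T) i

lookup-∁-++ʳ : ∀ {m n} (S : Subset m) (T : Subset n) j → lookup (∁ (S ++ T)) (m ↑ʳ j) ≡ lookup (∁ T) j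
lookup-∁-++ʳ S T j rewrite map-++ not S T = lookup-++ʳ (∁ S) (∁ T) j

-- b(n − |T|) in the notation of the paper.
codegree : ∀ {n} → ℕ → Subset n → ℕ
codegree b T = sum λ j → if lookup (∁ T) j then b else 0

-- Pointwise equations cover both the constant weight, with `a = b = 1`, and `weight`, although the
-- two functions are not definitionally equal.
record CompleteWeight (a b : ℕ) {m n : ℕ} (w : Fin (suc m) → Fin n → ℕ) : Set where
  field
    root-weight  : ∀ j → w zero j ≡ a
    other-weight : ∀ i j → w (suc i) j ≡ b

-- Exponents of the generators for a complete bipartite multigraph.

module _ {a b m n : ℕ} {w : Fin (suc m) → Fin n → ℕ} (complete : CompleteWeight a b w) where
  open CompleteWeight complete

  private
    G = bipartite m n w
    open Multigraph G

  edges-↑ˡ-root : ∀ i → edges (suc (i ↑ˡ n)) zero ≡ 0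
  edges-↑ˡ-root i rewrite splitAt-↑ˡ m i n = refl

  edges-↑ˡ-↑ˡ : ∀ i k → edges (suc (i ↑ˡ n)) (suc (k ↑ˡ n)) ≡ 0
  edges-↑ˡ-↑ˡ i k rewrite splitAt-↑ˡ m i n | splitAt-↑ˡ m k n = refl

  edges-↑ˡ-↑ʳ : ∀ i j → edges (suc (i ↑ˡ n)) (suc (m ↑ʳ j)) ≡ b
  edges-↑ˡ-↑ʳ i j rewrite splitAt-↑ˡ m i n | splitAt-↑ʳ m n j = other-weight i j

  edges-↑ʳ-root : ∀ j → edges (suc (m ↑ʳ j)) zero ≡ a
  edges-↑ʳ-root j rewrite splitAt-↑ʳ m n j = root-weight j

  edges-↑ʳ-↑ˡ : ∀ j i → edges (suc (m ↑ʳ j)) (suc (i ↑ˡ n)) ≡ b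
  edges-↑ʳ-↑ˡ j i = trans (edges-sym (suc (m ↑ʳ j)) (suc (i ↑ˡ n))) (edges-↑ˡ-↑ʳ i j)

  edges-↑ʳ-↑ʳ : ∀ j k → edges (suc (m ↑ʳ j)) (suc (m ↑ʳ k)) ≡ 0
  edges-↑ʳ-↑ʳ j k rewrite splitAt-↑ʳ m n j | splitAt-↑ʳ m n k = refl

  module _ (S : Subset m) (T : Subset n) where

    d-↑ˡ : ∀ i → d G (S ++ T) (i ↑ˡ n) ≡ codegree b T
    -- The root always lies in the complement, so the sum starts with its term, here `0`. The rest
    -- splits along the two parts, and only the edges to vertices outside `T` survive.
    d-↑ˡ i = cong₂ _+_ (edges-↑ˡ-root i) (trans (sum-↑ m _) (cong₂ _+_
      (sum-zero λ k → trans (cong (if lookup (∁ (S ++ T)) (k ↑ˡ n) then_else 0) (edges-↑ˡ-↑ˡ i k))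
                            (if-zero (lookup (∁ (S ++ T)) (k ↑ˡ n))))
      (sum-cong-≗ λ j → cong₂ (if_then_else 0) (lookup-∁-++ʳ S T j) (edges-↑ˡ-↑ʳ i j))))

    -- The `a` edges to the root are the only asymmetry with `d-↑ˡ`; the shift in `exchange`
    -- compensates for them.
    d-↑ʳ : ∀ j → d G (S ++ T) (m ↑ʳ j) ≡ a + codegree b S
    d-↑ʳ j = cong₂ _+_ (edges-↑ʳ-root j) (trans (sum-↑ m _) (trans (cong₂ _+_
      (sum-cong-≗ λ i → cong₂ (if_then_else 0) (lookup-∁-++ˡ S T i) (edges-↑ʳ-↑ˡ j i))
      (sum-zero λ k → trans (cong (if lookup (∁ (S ++ T)) (m ↑ʳ k) then_else 0) (edges-↑ʳ-↑ʳ j k))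
                            (if-zero (lookup (∁ (S ++ T)) (m ↑ʳ k)))))
      (+-identityʳ _)))

    exponent-↑ˡ : ∀ i → lookup (exponent G (S ++ T)) (i ↑ˡ n) ≡ (if lookup S i then codegree b T else 0)
    exponent-↑ˡ i = trans (lookup∘tabulate _ (i ↑ˡ n))
      (cong₂ (if_then_else 0) (lookup-++ˡ S T i) (d-↑ˡ i))

    exponent-↑ʳ : ∀ j → lookup (exponent G (S ++ T)) (m ↑ʳ j) ≡ (if lookup T j then a + codegree b S else 0)
    exponent-↑ʳ j = trans (lookup∘tabulate _ (m ↑ʳ j))
      (cong₂ (if_then_else 0) (lookup-++ʳ S T j) (d-↑ʳ j))

  -- The exponent of `⊤` at a vertex of the second part includes its `a` edges to the root. This
  -- bound makes the subtraction in `exchange` exact.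
  ⊤∣⇒root-≤ : ∀ P → exponent G ⊤ ≤ᵥ P → ∀ j → a ≤ lookup P (m ↑ʳ j)
  ⊤∣⇒root-≤ P le j = ≤-trans (m≤m+n a (codegree b (⊤ {m})))
    (subst (_≤ lookup P (m ↑ʳ j)) exponent-⊤ (le (m ↑ʳ j)))
    where
    exponent-⊤ : lookup (exponent G ⊤) (m ↑ʳ j) ≡ a + codegree b (⊤ {m})
    exponent-⊤ = trans (cong (λ A → lookup (exponent G A) (m ↑ʳ j)) (⊤-++ m n))
      (trans (exponent-↑ʳ ⊤ ⊤ j)
        (cong (if_then a + codegree b (⊤ {m}) else 0) ([]=⇒lookup (∈⊤ {x = j}))))

-- The exchange map on exponent vectors.

↑-elim : ∀ {ℓ} m {n} (P : Fin (m + n) → Set ℓ) → (∀ i → P (i ↑ˡ n)) → (∀ j → P (m ↑ʳ j)) → ∀ k → P k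
↑-elim zero    P l r k       = r k
↑-elim (suc m) P l r zero    = l zero
↑-elim (suc m) P l r (suc k) = ↑-elim m (P ∘ suc) (l ∘ suc) r k

lookup-take : ∀ {A : Set} m {n} (xs : Vec A (m + n)) i → lookup (take m xs) i ≡ lookup xs (i ↑ˡ n)
lookup-take m xs i = trans (sym (lookup-++ˡ (take m xs) (drop m xs) i))
  (cong (λ ys → lookup ys (i ↑ˡ _)) (take++drop≡id m xs))

lookup-drop : ∀ {A : Set} m {n} (xs : Vec A (m + n)) j → lookup (drop m xs) j ≡ lookup xs (m ↑ʳ j)
lookup-drop m xs j = trans (sym (lookup-++ʳ (take m xs) (drop m xs) j))
  (cong (λ ys → lookup ys (m ↑ʳ j)) (take++drop≡id m xs))

exchange : ∀ (a m : ℕ) {n} → Vec ℕ (m + n) → Vec ℕ (n + m)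
exchange a m P = map (_∸ a) (drop m P) ++ map (_+ a) (take m P)

exchange-↑ˡ : ∀ a m {n} (P : Vec ℕ (m + n)) j → lookup (exchange a m P) (j ↑ˡ m) ≡ lookup P (m ↑ʳ j) ∸ a
exchange-↑ˡ a m P j = trans (lookup-++ˡ (map (_∸ a) (drop m P)) _ j)
  (trans (lookup-map j (_∸ a) (drop m P)) (cong (_∸ a) (lookup-drop m P j)))

exchange-↑ʳ : ∀ a m {n} (P : Vec ℕ (m + n)) i → lookup (exchange a m P) (n ↑ʳ i) ≡ lookup P (i ↑ˡ n) + a
exchange-↑ʳ a m P i = trans (lookup-++ʳ (map (_∸ a) (drop m P)) _ i)
  (trans (lookup-map i (_+ a) (take m P)) (cong (_+ a) (lookup-take m P i)))

-- Entries of the first part are raised and then lowered, which is always exact; those of the second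
-- are lowered and then raised, which is exact by the bound.
exchange-involutive : ∀ a m {n} (P : Vec ℕ (m + n)) → (∀ j → a ≤ lookup P (m ↑ʳ j)) →
  exchange a n (exchange a m P) ≡ P
exchange-involutive a m {n} P a≤P = lookup-extensional (↑-elim m _
  (λ i → trans (exchange-↑ˡ a n (exchange a m P) i)
    (trans (cong (_∸ a) (exchange-↑ʳ a m P i)) (m+n∸n≡m _ a)))
  (λ j → trans (exchange-↑ʳ a n (exchange a m P) j)
    (trans (cong (_+ a) (exchange-↑ˡ a m P j)) (m∸n+n≡m (a≤P j)))))

-- Truncation is harmless: for `true` the premise forces `a ≤ y`, and for `false` the left side is
-- `0`.
if-≤-∸ : ∀ t {a x y} → (if t then a + x else 0) ≤ y → (if t then x else 0) ≤ y ∸ a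
if-≤-∸ true  {a} {x} {y} le = m+n≤o⇒m≤o∸n x (subst (_≤ y) (+-comm a x) le)
if-≤-∸ false             _  = z≤n

if-≤-+ : ∀ t {a x y} → (if t then x else 0) ≤ y → (if t then a + x else 0) ≤ y + a
if-≤-+ true  {a} {x} {y} le = subst (a + x ≤_) (+-comm a y) (+-monoʳ-≤ a le)
if-≤-+ false             _  = z≤n

module _ {a b m n : ℕ} {w : Fin (suc m) → Fin n → ℕ} {w′ : Fin (suc n) → Fin m → ℕ}
  (complete : CompleteWeight a b w) (complete′ : CompleteWeight a b w′) where

  private
    G  = bipartite m n w
    G′ = bipartite n m w′

  -- The condition on `T` loses the `a` root edges and the condition on `S` gains them, in step with
  -- the entries of `P`; the codegrees are unchanged.
  exchange-≤ᵥ : ∀ S T P → exponent G (S ++ T) ≤ᵥ P → exponent G′ (T ++ S) ≤ᵥ exchange a m P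
  exchange-≤ᵥ S T P le = ↑-elim n _
    (λ j → subst₂ _≤_ (sym (exponent-↑ˡ complete′ T S j)) (sym (exchange-↑ˡ a m P j))
      (if-≤-∸ (lookup T j) (subst (_≤ lookup P (m ↑ʳ j)) (exponent-↑ʳ complete S T j) (le (m ↑ʳ j)))))
    (λ i → subst₂ _≤_ (sym (exponent-↑ʳ complete′ T S i)) (sym (exchange-↑ʳ a m P i))
      (if-≤-+ (lookup S i) (subst (_≤ lookup P (i ↑ˡ n)) (exponent-↑ˡ complete S T i) (le (i ↑ˡ n)))))

-- Transfer of spherical parking functions.

module _ {c ℓ₁ ℓ₂} (K : HeytingField c ℓ₁ ℓ₂) {a b : ℕ} where

  -- Divisibility by the generator of `⊤` is carried forward. A small generator dividing the image
  -- would be carried back, by a second exchange, to a small one dividing `x^ P`.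
  exchange-sPF : ∀ {m n} {w : Fin (suc m) → Fin n → ℕ} {w′ : Fin (suc n) → Fin m → ℕ} →
    CompleteWeight a b w → CompleteWeight a b w′ → n ≥ 1 →
    ∀ P → P ∈ sPF K (bipartite m n w) → exchange a m P ∈ sPF K (bipartite n m w′)
  exchange-sPF {m} {suc n} {w} {w′} complete complete′ _ P P∈ =
    -- Matching on `suc n` provides the vertex `zero` that makes `⊤` nonempty.
    ⊤∣∧∤⇒sPF K G′ (exchange a m P) (zero , ∈⊤) ⊤≤ ∤
    where
    G  = bipartite m (suc n) w
    G′ = bipartite (suc n) m w′

    P≥⊤ : exponent G ⊤ ≤ᵥ P
    P≥⊤ = sPF⇒⊤∣ K G P P∈

    ⊤≤ : exponent G′ ⊤ ≤ᵥ exchange a m P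
    ⊤≤ = subst (λ A → exponent G′ A ≤ᵥ exchange a m P) (sym (⊤-++ (suc n) m))
      (exchange-≤ᵥ complete complete′ ⊤ ⊤ P (subst (λ A → exponent G A ≤ᵥ P) (⊤-++ m (suc n)) P≥⊤))

    ∤++ : ∀ T S → Small K G′ (T ++ S) → ¬ exponent G′ (T ++ S) ≤ᵥ exchange a m P
    ∤++ T S (A≢∅ , ∣A∣≤) A≤ = sPF⇒∤ K G P P∈
      -- Both nonemptiness and the size bound pass through `∣ S ++ T ∣`, which does not see the
      -- order of the parts.
      ( ∣p∣>0⇒nonempty (S ++ T) (subst (0 <_) (sym (∣++∣-swap T S)) (nonempty⇒∣p∣>0 (T ++ S) A≢∅))
      , subst₂ _≤_ (sym (∣++∣-swap T S)) (cong (λ N → N ∸ 2 + 1) (+-comm (suc n) m)) ∣A∣≤ )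
      (subst (exponent G (S ++ T) ≤ᵥ_) (exchange-involutive a m P (⊤∣⇒root-≤ complete P P≥⊤))
        (exchange-≤ᵥ complete′ complete T S (exchange a m P) A≤))

    ∤ : ∀ {A} → Small K G′ A → ¬ exponent G′ A ≤ᵥ exchange a m P
    ∤ {A} = subst (λ A → Small K G′ A → ¬ exponent G′ A ≤ᵥ exchange a m P)
      (take++drop≡id (suc n) A) (∤++ (take (suc n) A) (drop (suc n) A))

  sPF-exchange-cardinality : ∀ {m n} {w : Fin (suc m) → Fin n → ℕ} {w′ : Fin (suc n) → Fin m → ℕ} →
    CompleteWeight a b w → CompleteWeight a b w′ → m ≥ 1 → n ≥ 1 →
    SameFiniteCardinality (sPF K (bipartite m n w)) (sPF K (bipartite n m w′))
  sPF-exchange-cardinality {m} {n} {w} {w′} complete complete′ m≥1 n≥1 =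
    let (k , card) = sPF-finite K (bipartite m n w) in
    -- Only one set is counted: the exchange from the second set to the first, followed by `card`,
    -- counts the other with the same `k`.
    k , card , Compose.bijection
      (inverse⇒Bijection (exchange a n) (exchange a m)
        (λ {P} → exchange-sPF complete′ complete m≥1 P)
        (λ {P} → exchange-sPF complete complete′ n≥1 P)
        (λ {P} P∈ → exchange-involutive a n P (⊤∣⇒root-≤ complete′ P (sPF⇒⊤∣ K (bipartite n m w′) P P∈)))
        (λ {P} P∈ → exchange-involutive a m P (⊤∣⇒root-≤ complete P (sPF⇒⊤∣ K (bipartite m n w) P P∈))))
      card

unit-complete : ∀ {m n} → CompleteWeight 1 1 {m} {n} (λ _ _ → 1)
unit-complete = record { root-weight = λ _ → refl ; other-weight = λ _ _ → refl }

weight-complete : ∀ m n a b → CompleteWeight a b (K^[a,b].weight m n a b)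
weight-complete m n a b = record { root-weight = λ _ → refl ; other-weight = λ _ _ → refl }

proposition3p3 : ∀ {c ℓ₁ ℓ₂} (K : HeytingField c ℓ₁ ℓ₂) (m n : ℕ) → m ≥ 1 → n ≥ 1 →
    SameFiniteCardinality (sPF K K[ m +1, n ]) (sPF K K[ n +1, m ])
    × (∀ (a b : ℕ) → a ≥ 1 → b ≥ 1 →
    SameFiniteCardinality (sPF K K[ m +1, n ]^[ a , b ]) (sPF K K[ n +1, m ]^[ a , b ]))
proposition3p3 K m n m≥1 n≥1 =
    sPF-exchange-cardinality K unit-complete unit-complete m≥1 n≥1
  , λ a b _ _ → sPF-exchange-cardinality K (weight-complete m n a b) (weight-complete n m a b) m≥1 n≥1
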